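{- For every integer $k\geq 1$, we have $\text{max-sep}_{RB}(\overline{H_k})=2k-1$, where $\overline{H_k}$ is the complement of the half-graph $H_k$.
   Context: For an integer $k\geq 1$, the half-graph $H_k$ is the bipartite graph on vertex sets $\{v_1,\ldots,v_k\}$ and $\{w_1,\ldots,w_k\}$, with an edge between $v_i$ and $w_j$ if and only if $i\leq j$. Its complement $\overline{H_k}$ thus consists of two disjoint cliques $\{v_1,\ldots,v_k\}$ and $\{w_1,\ldots,w_k\}$, with an edge between $v_i$ and $w_j$ if and only if $i>j$. $N[x]$ denotes the closed neighborhood of $x$. A graph is twin-free if no two distinct vertices have the same closed neighborhood. A red-blue coloring of a graph $G$ is a map $c:V(G)\to\{\text{red},\text{blue}\}$. A red-blue separating set of $(G,c)$ is a set $S\subseteq V(G)$ such that $N[r]\cap S\neq N[b]\cap S$ for every red vertex $r$ and every blue vertex $b$. For $G$ twin-free, $\mathrm{sep}_{RB}(G,c)$ is the smallest size of a red-blue separating set of $(G,c)$, and $\text{max-sep}_{RB}(G)$ is the maximum of $\mathrm{sep}_{RB}(G,c)$ over all red-blue colorings $c$ of $G$. -}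

module Defs where

open import Data.Bool using (if_then_else_)
open import Data.Empty using (⊥)
open import Data.Fin using (Fin; _≤_; _≤?_; _≟_; splitAt)
open import Data.Fin.Subset using (Subset; _∩_; ∣_∣)
open import Data.Nat as ℕ using (ℕ; _+_)
open import Data.Product using (∃-syntax; _×_; _,_)
open import Data.Sum using (_⊎_; inj₁; inj₂)
open import Data.Vec using (tabulate)
open import Function using (_∘_)
open import Relation.Binary using (Rel; Decidable; Symmetric; Irreflexive)
open import Relation.Binary.PropositionalEquality
  using (_≡_; _≢_; refl; sym; cong; ≢-sym)
open import Relation.Nullary using (¬_; no; does; contradiction)
open import Relation.Nullary.Decidable
  using (_⊎-dec_; _×-dec_; ¬?; dec-true; dec-false)
open import Level using (0ℓ)

record Graph (n : ℕ) : Set₁ where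
  field
    Adj    : Rel (Fin n) 0ℓ
    adj?   : Decidable Adj
    symm   : Symmetric Adj
    irrefl : Irreflexive _≡_ Adj

open Graph public

complement : ∀ {n} → Graph n → Graph n
complement G .Adj x y = x ≢ y × ¬ Adj G x y
complement G .adj? x y = ¬? (x ≟ y) ×-dec ¬? (adj? G x y)
complement G .symm (x≢y , ¬xy) = ≢-sym x≢y , ¬xy ∘ symm G
complement G .irrefl x≡y (x≢y , _) = x≢y x≡y

-- inj₁ i is the vertex v_i, inj₂ j is the vertex w_j.
HalfAdj : ∀ {k} → Rel (Fin k ⊎ Fin k) 0ℓ
HalfAdj (inj₁ i) (inj₂ j) = i ≤ j
HalfAdj (inj₂ j) (inj₁ i) = i ≤ j
HalfAdj (inj₁ _) (inj₁ _) = ⊥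
HalfAdj (inj₂ _) (inj₂ _) = ⊥

halfAdj? : ∀ {k} → Decidable (HalfAdj {k})
halfAdj? (inj₁ i) (inj₂ j) = i ≤? j
halfAdj? (inj₂ j) (inj₁ i) = i ≤? j
halfAdj? (inj₁ _) (inj₁ _) = no λ ()
halfAdj? (inj₂ _) (inj₂ _) = no λ ()

halfAdj-sym : ∀ {k} → Symmetric (HalfAdj {k})
halfAdj-sym {x = inj₁ _} {inj₂ _} i≤j = i≤j
halfAdj-sym {x = inj₂ _} {inj₁ _} i≤j = i≤j

halfAdj-irrefl : ∀ {k} → Irreflexive _≡_ (HalfAdj {k})
halfAdj-irrefl {x = inj₁ _} refl ()
halfAdj-irrefl {x = inj₂ _} refl ()

-- The first k elements of Fin (k + k) are the v's, the last k the w's.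
halfGraph : ∀ k → Graph (k + k)
halfGraph k .Adj x y = HalfAdj (splitAt k x) (splitAt k y)
halfGraph k .adj? x y = halfAdj? (splitAt k x) (splitAt k y)
halfGraph k .symm {x} {y} = halfAdj-sym {x = splitAt k x} {splitAt k y}
halfGraph k .irrefl x≡y = halfAdj-irrefl (cong (splitAt k) x≡y)

data Colour : Set where
  red blue : Colour

module _ {n : ℕ} (G : Graph n) where

  N[_] : Fin n → Subset n
  N[ x ] = tabulate λ y → does (x ≟ y ⊎-dec adj? G x y)

  TwinFree : Set
  TwinFree = ∀ x y → x ≢ y → N[ x ] ≢ N[ y ]

  Colouring : Set
  Colouring = Fin n → Colour

  Separating : Colouring → Subset n → Set
  Separating c S =
    ∀ r b → c r ≡ red → c b ≡ blue → N[ r ] ∩ S ≢ N[ b ] ∩ S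

  -- "sep_RB (G , c) is defined and equal to m".
  IsSepRB : Colouring → ℕ → Set
  IsSepRB c m =
    (∃[ S ] Separating c S × ∣ S ∣ ≡ m) ×
    (∀ S → Separating c S → m ℕ.≤ ∣ S ∣)

  -- "max-sep_RB (G) is defined and equal to m".  The second component also
  -- asserts that sep_RB (G , c) is defined for every c, so a graph that is
  -- not twin-free has no value (see isMaxSepRB⇒twinFree).
  IsMaxSepRB : ℕ → Set
  IsMaxSepRB m =
    (∃[ c ] IsSepRB c m) ×
    (∀ c → ∃[ s ] IsSepRB c s × s ℕ.≤ m)

  isMaxSepRB⇒twinFree : ∀ {m} → IsMaxSepRB m → TwinFree
  isMaxSepRB⇒twinFree (_ , total) x y x≢y Nx≡Ny
    with (_ , ((S , sep , _) , _) , _) ← total (λ z → if does (z ≟ x) then red else blue)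
    = sep x y
        (cong (if_then red else blue) (dec-true (x ≟ x) refl))
        (cong (if_then red else blue) (dec-false (y ≟ x) (≢-sym x≢y)))
        (cong (_∩ S) Nx≡Ny)

{-# OPTIONS --safe #-}

-- Order the vertices as v_0, …, v_{k-1}, w_0, …, w_{k-1}.  The closed
-- neighbourhoods of v_i and v_{i+1} differ only in w_i, those of w_j and
-- w_{j+1} only in v_{j+1}, and those of v_{k-1} and w_0 only in v_0 and w_{k-1}.
-- For the colouring that alternates along this order, a separating set thus
-- misses at most one vertex, which is v_0 or w_{k-1}.  Conversely the set of
-- all vertices except v_0 tells any two vertices apart, whatever the colouring.
module Submission where

open import Data.Bool using (true)
import Data.Bool.Properties as Bool
open import Data.Fin as Fin using (Fin; zero; suc; toℕ; fromℕ; inject₁; join; splitAt)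
import Data.Fin.Properties as Fin
open import Data.Fin.Relation.Unary.Top using (view; ‵fromℕ; ‵inject₁)
open import Data.Fin.Subset using (Subset; _∈_; _∉_; _⊆_; _∩_; ∁; ⁅_⁆; ∣_∣)
open import Data.Fin.Subset.Properties
  using ( _∈?_; anySubset?; ⊆-antisym; x∈p∩q⁺; x∈p∩q⁻; x∈⁅x⁆; x∈⁅y⁆⇒x≡y; ∣⁅x⁆∣≡1
        ; x∉p⇒x∈∁p; x∈∁p⇒x∉p; p⊆q⇒∣p∣≤∣q∣; ∣∁p∣≡n∸∣p∣)
open import Data.Nat using (ℕ; zero; suc; _+_; _≤_; _<_; _*_; _∸_; _<?_; z≤n; s≤s)
open import Data.Nat.Induction using (<-wellFounded)
import Data.Nat.Properties as ℕ
open import Data.Product using (_×_; _,_; ∃-syntax; proj₁)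
open import Data.Sum using (_⊎_; inj₁; inj₂; [_,_]′)
open import Data.Vec.Properties using (≡-dec; lookup∘tabulate; lookup⇒[]=; []=⇒lookup)
open import Function using (_∘_; _⇔_; mk⇔; Equivalence)
open import Function.Properties.Equivalence using () renaming (sym to ⇔-sym)
open import Induction.WellFounded using (Acc; acc)
open import Relation.Binary using (DecidableEquality)
open import Relation.Binary.PropositionalEquality
open import Relation.Nullary using (¬_; Dec; yes; no; does; contradiction)
open import Relation.Nullary.Decidable
  using (_⊎-dec_; _×-dec_; _→-dec_; ¬?; dec-true; decidable-stable)
open import Relation.Unary using (Decidable)
open import Defs

open Equivalence using (to; from)

-- Closed neighbourhoods in the complement of a graph.

does≡true⇒ : ∀ {p} {P : Set p} (P? : Dec P) → does P? ≡ true → P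
does≡true⇒ (yes p) _ = p

module _ {n} (G : Graph n) where

  private
    inN? : ∀ x y → Dec (x ≡ y ⊎ Adj (complement G) x y)
    inN? x y = x Fin.≟ y ⊎-dec adj? (complement G) x y

  -- Irreflexivity of `G` puts `x` itself among its non-neighbours, so everything below can be
  -- argued with `Adj G` alone.
  ∈N-complement : ∀ x y → y ∈ N[ complement G ] x ⇔ (¬ Adj G x y)
  ∈N-complement x y = mk⇔
    (λ y∈N → nonadjacent
      (does≡true⇒ (inN? x y) (trans (sym (lookup∘tabulate _ y)) ([]=⇒lookup y∈N))))
    (λ ¬xy → lookup⇒[]= y _ (trans (lookup∘tabulate _ y) (dec-true (inN? x y) (near ¬xy))))
    where
    nonadjacent : x ≡ y ⊎ Adj (complement G) x y → ¬ Adj G x y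
    nonadjacent (inj₁ x≡y) = irrefl G x≡y
    nonadjacent (inj₂ (_ , ¬xy)) = ¬xy

    near : ¬ Adj G x y → x ≡ y ⊎ Adj (complement G) x y
    near ¬xy with x Fin.≟ y
    ... | yes x≡y = inj₁ x≡y
    ... | no x≢y = inj₂ (x≢y , ¬xy)

  N∩-cong : ∀ S x z → (∀ y → y ∈ S → Adj G x y ⇔ Adj G z y) →
            N[ complement G ] x ∩ S ≡ N[ complement G ] z ∩ S
  N∩-cong S x z agree =
    ⊆-antisym (half x z agree) (half z x λ y y∈S → ⇔-sym (agree y y∈S))
    where
    half : ∀ x z → (∀ y → y ∈ S → Adj G x y ⇔ Adj G z y) →
           N[ complement G ] x ∩ S ⊆ N[ complement G ] z ∩ S
    half x z agree {y} y∈ with y∈N , y∈S ← x∈p∩q⁻ _ S y∈ =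
      x∈p∩q⁺ ( from (∈N-complement z y) (to (∈N-complement x y) y∈N ∘ from (agree y y∈S))
             , y∈S)

  N∩≡⇒Adj⊆ : ∀ S x z → N[ complement G ] x ∩ S ≡ N[ complement G ] z ∩ S →
              ∀ y → y ∈ S → Adj G x y → Adj G z y
  -- Neighbourhoods of the complement only carry negated adjacency; decidability of `Adj G` removes
  -- the double negation.
  N∩≡⇒Adj⊆ S x z eq y y∈S xy = decidable-stable (adj? G z y) λ ¬zy →
    to (∈N-complement x y)
      (proj₁ (x∈p∩q⁻ _ S
        (subst (y ∈_) (sym eq) (x∈p∩q⁺ (from (∈N-complement z y) ¬zy , y∈S)))))
      xy

-- Separating sets and minimum subsets.

_≟ᶜ_ : DecidableEquality Colour
red  ≟ᶜ red  = yes refl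
red  ≟ᶜ blue = no λ ()
blue ≟ᶜ red  = no λ ()
blue ≟ᶜ blue = yes refl

separating? : ∀ {n} (G : Graph n) (c : Colouring G) → Decidable (Separating G c)
separating? G c S = Fin.all? λ r → Fin.all? λ b →
  (c r ≟ᶜ red) →-dec (c b ≟ᶜ blue) →-dec
  ¬? (≡-dec Bool._≟_ (N[ G ] r ∩ S) (N[ G ] b ∩ S))

separating-≢ : ∀ {n} (G : Graph n) (c : Colouring G) {S} → Separating G c S →
               ∀ x y → c x ≢ c y → N[ G ] x ∩ S ≢ N[ G ] y ∩ S
separating-≢ G c sep x y cx≢cy with c x in cx | c y in cy
... | red  | red  = contradiction refl cx≢cy
... | red  | blue = sep x y cx cy
... | blue | red  = sep y x cy cx ∘ sym
... | blue | blue = contradiction refl cx≢cy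

injective⇒separating : ∀ {n} (G : Graph n) {S} →
                       (∀ x y → N[ G ] x ∩ S ≡ N[ G ] y ∩ S → x ≡ y) →
                       ∀ c → Separating G c S
injective⇒separating G inj c r b cr cb eq
  with () ← trans (sym cr) (trans (cong c (inj r b eq)) cb)

-- Descent on cardinality: as long as the search finds a smaller subset with `P`, continue from it.
-- This is what makes `sep_RB` defined for every colouring.
minimum-subset : ∀ {n p} {P : Subset n → Set p} → Decidable P → ∀ S → P S →
                 ∃[ T ] P T × (∀ U → P U → ∣ T ∣ ≤ ∣ U ∣)
minimum-subset {P = P} P? S PS = go S PS (<-wellFounded ∣ S ∣)
  where
  go : ∀ S → P S → Acc _<_ ∣ S ∣ → ∃[ T ] P T × (∀ U → P U → ∣ T ∣ ≤ ∣ U ∣)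
  go S PS (acc rec) with anySubset? (λ U → P? U ×-dec ∣ U ∣ <? ∣ S ∣)
  ... | yes (U , PU , U<S) = go U PU (rec U<S)
  ... | no ¬smaller = S , PS , λ U PU → ℕ.≮⇒≥ λ U<S → ¬smaller (U , PU , U<S)

∣∁⁅x⁆∣≡n∸1 : ∀ {n} (x : Fin n) → ∣ ∁ ⁅ x ⁆ ∣ ≡ n ∸ 1
∣∁⁅x⁆∣≡n∸1 {n} x = trans (∣∁p∣≡n∸∣p∣ ⁅ x ⁆) (cong (n ∸_) (∣⁅x⁆∣≡1 x))

∁p⊆⁅x⁆⇒n∸1≤∣p∣ : ∀ {n} {p : Subset n} x → (∀ y → y ∉ p → y ≡ x) → n ∸ 1 ≤ ∣ p ∣
∁p⊆⁅x⁆⇒n∸1≤∣p∣ {n} {p} x only =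
  ℕ.m≤n+o⇒m∸n≤o n 1 (subst (n ≤_) (ℕ.+-comm ∣ p ∣ 1)
    (ℕ.≤-trans (ℕ.m≤n+m∸n n ∣ p ∣) (ℕ.+-monoʳ-≤ ∣ p ∣ n∸∣p∣≤1)))
  where
  ∁p⊆⁅x⁆ : ∁ p ⊆ ⁅ x ⁆
  ∁p⊆⁅x⁆ {y} y∈∁p = subst (_∈ ⁅ x ⁆) (sym (only y (x∈∁p⇒x∉p y∈∁p))) (x∈⁅x⁆ x)

  n∸∣p∣≤1 : n ∸ ∣ p ∣ ≤ 1
  n∸∣p∣≤1 = subst₂ _≤_ (∣∁p∣≡n∸∣p∣ p) (∣⁅x⁆∣≡1 x) (p⊆q⇒∣p∣≤∣q∣ ∁p⊆⁅x⁆)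

-- The alternating colouring.

opposite : Colour → Colour
opposite red  = blue
opposite blue = red

opposite-≢ : ∀ c → c ≢ opposite c
opposite-≢ red  ()
opposite-≢ blue ()

parity : ℕ → Colour
parity zero    = red
parity (suc n) = opposite (parity n)

alternating : ∀ {n} → Fin n → Colour
alternating = parity ∘ toℕ

alternating-≢ : ∀ {n} (x y : Fin n) → toℕ y ≡ suc (toℕ x) → alternating x ≢ alternating y
alternating-≢ x _ y≡1+x eq = opposite-≢ (alternating x) (trans eq (cong parity y≡1+x))

-- The complement of the half-graph.

module _ (m : ℕ) where

  private
    k : ℕ
    k = suc m

    H̄ : Graph (k + k)
    H̄ = complement (halfGraph k)

    v w : Fin k → Fin (k + k)
    v = join k k ∘ inj₁
    w = join k k ∘ inj₂

    v₀ wₗ : Fin (k + k)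
    v₀ = v zero
    wₗ = w (fromℕ m)

  toℕ-v : ∀ i → toℕ (v i) ≡ toℕ i
  toℕ-v i = Fin.toℕ-↑ˡ i k

  toℕ-w : ∀ j → toℕ (w j) ≡ k + toℕ j
  toℕ-w j = Fin.toℕ-↑ʳ k j

  -- Passes from `Fin (k + k)` to the sum type, on which `HalfAdj` computes by cases.
  N∩-cong-join : ∀ S s s′ →
                 (∀ t → join k k t ∈ S → HalfAdj s t ⇔ HalfAdj s′ t) →
                 N[ H̄ ] (join k k s) ∩ S ≡ N[ H̄ ] (join k k s′) ∩ S
  N∩-cong-join S s s′ agree = N∩-cong (halfGraph k) S (join k k s) (join k k s′) lifted
    where
    lifted : ∀ y → y ∈ S → Adj (halfGraph k) (join k k s) y ⇔ Adj (halfGraph k) (join k k s′) y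
    lifted y y∈S
      rewrite Fin.splitAt-join k k s | Fin.splitAt-join k k s′
      = agree (splitAt k y) (subst (_∈ S) (sym (Fin.join-splitAt k k y)) y∈S)

  -- In the half-graph, `wₗ` is adjacent to every v and to no w, so it tells the sides apart. The
  -- index of a v is the least index of a w adjacent to it; that of a w is the largest index of a v
  -- adjacent to it, and is 0 if no v other than `v₀` is.
  N∩∁⁅v₀⁆-injective : ∀ x y → N[ H̄ ] x ∩ ∁ ⁅ v₀ ⁆ ≡ N[ H̄ ] y ∩ ∁ ⁅ v₀ ⁆ → x ≡ y
  N∩∁⁅v₀⁆-injective x y eq =
    trans (sym (Fin.join-splitAt k k x))
      (trans (cong (join k k) (same (splitAt k x) (splitAt k y) (transfer x y eq) (transfer y x (sym eq))))
        (Fin.join-splitAt k k y))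
    where
    Below : Fin k ⊎ Fin k → Fin k ⊎ Fin k → Set
    Below s s′ = ∀ t → t ≢ inj₁ zero → HalfAdj s t → HalfAdj s′ t

    transfer : ∀ x y → N[ H̄ ] x ∩ ∁ ⁅ v₀ ⁆ ≡ N[ H̄ ] y ∩ ∁ ⁅ v₀ ⁆ →
               Below (splitAt k x) (splitAt k y)
    transfer x y eq t t≢v₀ =
      subst (λ u → HalfAdj (splitAt k x) u → HalfAdj (splitAt k y) u) (Fin.splitAt-join k k t)
        (N∩≡⇒Adj⊆ (halfGraph k) _ x y eq (join k k t) (x∉p⇒x∈∁p (t∉ ∘ x∈⁅y⁆⇒x≡y v₀)))
      where
      t∉ : join k k t ≢ v₀
      t∉ e = t≢v₀ (trans (sym (Fin.splitAt-join k k t)) (cong (splitAt k) e))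

    w≤ : ∀ i j → Below (inj₂ i) (inj₂ j) → i Fin.≤ j
    -- For index 0 the test vertex would be the excluded `v₀`, but there the bound is trivial.
    w≤ zero    j _     = z≤n
    w≤ (suc i) j below = below (inj₁ (suc i)) (λ ()) ℕ.≤-refl

    same : ∀ s s′ → Below s s′ → Below s′ s → s ≡ s′
    -- `w j` is adjacent to `v j`; carried over to `v i`, this adjacency reads `i ≤ j`.
    same (inj₁ i) (inj₁ j) p q =
      cong inj₁ (Fin.≤-antisym (q (inj₂ j) (λ ()) ℕ.≤-refl) (p (inj₂ i) (λ ()) ℕ.≤-refl))
    same (inj₁ i) (inj₂ j) p q with () ← p (inj₂ (fromℕ m)) (λ ()) (Fin.≤fromℕ i)
    same (inj₂ i) (inj₁ j) p q with () ← q (inj₂ (fromℕ m)) (λ ()) (Fin.≤fromℕ j)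
    same (inj₂ i) (inj₂ j) p q = cong inj₂ (Fin.≤-antisym (w≤ i j p) (w≤ j i q))

  module _ {S} (sep : Separating H̄ alternating S) where

    private
      -- Consecutive vertices have different colours, so `S` cannot fail to see a difference between
      -- them.
      distinguished : ∀ s s′ → toℕ (join k k s′) ≡ suc (toℕ (join k k s)) →
                      ¬ (∀ t → join k k t ∈ S → HalfAdj s t ⇔ HalfAdj s′ t)
      distinguished s s′ next agree =
        separating-≢ H̄ alternating sep (join k k s) (join k k s′)
          (alternating-≢ (join k k s) (join k k s′) next) (N∩-cong-join S s s′ agree)

    ¬w-inject₁∉ : ∀ i → ¬ w (inject₁ i) ∉ S
    ¬w-inject₁∉ i wᵢ∉S = distinguished (inj₁ (inject₁ i)) (inj₁ (suc i)) next agree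
      where
      next : toℕ (v (suc i)) ≡ suc (toℕ (v (inject₁ i)))
      next = trans (toℕ-v (suc i))
        (cong suc (sym (trans (toℕ-v (inject₁ i)) (Fin.toℕ-inject₁ i))))

      agree : ∀ t → join k k t ∈ S → HalfAdj (inj₁ (inject₁ i)) t ⇔ HalfAdj (inj₁ (suc i)) t
      agree (inj₁ _) _ = mk⇔ (λ ()) (λ ())
      agree (inj₂ j) wⱼ∈S = mk⇔
        -- Since `w (inject₁ i)` is outside `S`, the case of equality is excluded and the inequality
        -- is strict.
        (λ i≤j → subst (λ a → suc a ≤ toℕ j) (Fin.toℕ-inject₁ i)
          (ℕ.≤∧≢⇒< i≤j λ i≡j → wᵢ∉S (subst (λ a → w a ∈ S) (sym (Fin.toℕ-injective i≡j)) wⱼ∈S)))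
        (λ i<j → subst (_≤ toℕ j) (sym (Fin.toℕ-inject₁ i)) (ℕ.<⇒≤ i<j))

    ¬v-suc∉ : ∀ j → ¬ v (suc j) ∉ S
    ¬v-suc∉ j vⱼ∉S = distinguished (inj₂ (inject₁ j)) (inj₂ (suc j)) next agree
      where
      next : toℕ (w (suc j)) ≡ suc (toℕ (w (inject₁ j)))
      next = trans (toℕ-w (suc j)) (trans (ℕ.+-suc k (toℕ j))
        (cong suc (sym (trans (toℕ-w (inject₁ j)) (cong (k +_) (Fin.toℕ-inject₁ j))))))

      agree : ∀ t → join k k t ∈ S → HalfAdj (inj₂ (inject₁ j)) t ⇔ HalfAdj (inj₂ (suc j)) t
      agree (inj₂ _) _ = mk⇔ (λ ()) (λ ())
      agree (inj₁ i) vᵢ∈S = mk⇔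
        (λ i≤j → ℕ.m≤n⇒m≤1+n (subst (toℕ i ≤_) (Fin.toℕ-inject₁ j) i≤j))
        (λ i≤1+j → subst (toℕ i ≤_) (sym (Fin.toℕ-inject₁ j))
          (ℕ.≤-pred (ℕ.≤∧≢⇒< i≤1+j λ i≡1+j →
            vⱼ∉S (subst (λ a → v a ∈ S) (Fin.toℕ-injective i≡1+j) vᵢ∈S))))

    -- In the half-graph the last v is adjacent to `wₗ` only, and the first w to `v₀` only. With
    -- both outside `S`, neither has a neighbour in `S`.
    v₀∉⇒¬wₗ∉ : v₀ ∉ S → ¬ wₗ ∉ S
    v₀∉⇒¬wₗ∉ v₀∉S wₗ∉S = distinguished (inj₁ (fromℕ m)) (inj₂ zero) next agree
      where
      next : toℕ (w zero) ≡ suc (toℕ (v (fromℕ m)))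
      next = trans (toℕ-w zero) (trans (ℕ.+-identityʳ k)
        (cong suc (sym (trans (toℕ-v (fromℕ m)) (Fin.toℕ-fromℕ m)))))

      agree : ∀ t → join k k t ∈ S → HalfAdj (inj₁ (fromℕ m)) t ⇔ HalfAdj (inj₂ zero) t
      agree (inj₁ i) vᵢ∈S = mk⇔ (λ ()) λ i≤0 →
        contradiction (subst (λ a → v a ∈ S) (Fin.≤-antisym i≤0 z≤n) vᵢ∈S) v₀∉S
      agree (inj₂ j) wⱼ∈S = mk⇔
        (λ m≤j → contradiction (subst (λ a → w a ∈ S) (Fin.≤-antisym (Fin.≤fromℕ j) m≤j) wⱼ∈S) wₗ∉S)
        (λ ())

    missing : ∀ y → y ∉ S → y ≡ v₀ ⊎ y ≡ wₗ
    missing y y∉S = subst (λ z → z ∉ S → z ≡ v₀ ⊎ z ≡ wₗ) (Fin.join-splitAt k k y)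
                      (cases (splitAt k y)) y∉S
      where
      cases : ∀ t → join k k t ∉ S → join k k t ≡ v₀ ⊎ join k k t ≡ wₗ
      cases (inj₁ zero)    _ = inj₁ refl
      cases (inj₁ (suc i)) v∉S = contradiction v∉S (¬v-suc∉ i)
      cases (inj₂ j) w∉S with view j
      ... | ‵fromℕ     = inj₂ refl
      ... | ‵inject₁ i = contradiction w∉S (¬w-inject₁∉ i)

    separating-alternating⇒≤ : k + k ∸ 1 ≤ ∣ S ∣
    separating-alternating⇒≤ with v₀ ∈? S
    -- Either way a single vertex can be missing: `wₗ` if `v₀` is in `S`, and `v₀` otherwise.
    ... | yes v₀∈S = ∁p⊆⁅x⁆⇒n∸1≤∣p∣ wₗ λ y y∉S →
      [ (λ { refl → contradiction v₀∈S y∉S }) , (λ y≡wₗ → y≡wₗ) ]′ (missing y y∉S)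
    ... | no v₀∉S = ∁p⊆⁅x⁆⇒n∸1≤∣p∣ v₀ λ y y∉S →
      [ (λ y≡v₀ → y≡v₀) , (λ { refl → contradiction y∉S (v₀∉⇒¬wₗ∉ v₀∉S) }) ]′ (missing y y∉S)

  isMaxSepRB-complement-halfGraph : IsMaxSepRB H̄ (k + k ∸ 1)
  isMaxSepRB-complement-halfGraph =
    ( alternating
    , (∁ ⁅ v₀ ⁆ , separates alternating , ∣∁⁅x⁆∣≡n∸1 v₀)
    , λ S → separating-alternating⇒≤) ,
    -- The set `∁ ⁅ v₀ ⁆` separates every colouring, so it both starts the search for a minimum and
    -- bounds its size.
    λ c → let T , sep , least = minimum-subset (separating? H̄ c) (∁ ⁅ v₀ ⁆) (separates c) in
      ∣ T ∣ , ((T , sep , refl) , least) ,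
      subst (∣ T ∣ ≤_) (∣∁⁅x⁆∣≡n∸1 v₀) (least (∁ ⁅ v₀ ⁆) (separates c))
    where
    separates : ∀ c → Separating H̄ c (∁ ⁅ v₀ ⁆)
    separates = injective⇒separating H̄ N∩∁⁅v₀⁆-injective

proposition15 : (k : ℕ) → 1 ≤ k → IsMaxSepRB (complement (halfGraph k)) (2 * k ∸ 1)
proposition15 (suc m) (s≤s z≤n) =
  -- `2 * suc m` unfolds to `suc m + (suc m + 0)`.
  subst (λ a → IsMaxSepRB (complement (halfGraph (suc m))) (suc m + a ∸ 1))
    (sym (ℕ.+-identityʳ (suc m)))
    (isMaxSepRB-complement-halfGraph m)
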